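{- Let $\mathbf w\in\mathbb R^m$. (a) If $|\lambda|=2$, then $B_{\mathbf w}$ satisfies the strong majority criterion if and only if $\mathbf w(1)>\mathbf w(2)$. (b) If $|\lambda|>2$, then no nontrivial positional voting method $B_{\mathbf w}$ satisfies the strong majority criterion.
   Context: Fix an integer $n\ge 2$ and a set $\mathbf C$ of $n$ candidates. Fix a composition $\lambda=(\lambda_1,\dots,\lambda_m)$ of $n$ (positive integers with $\sum_i\lambda_i=n$), write $|\lambda|=m$ and $[m]=\{1,\dots,m\}$. A ballot is a function $b:\mathbf C\to[m]$ with $|b^{ -1}(i)|=\lambda_i$ for every $i$; $\mathbf C_\lambda$ denotes the set of ballots. The profile space is $P=\mathbb R^{\mathbf C_\lambda}$ with basis $\{\delta_b\}$ (indicator functions) and inner product $\mathbf p\cdot\mathbf q=\sum_b\mathbf p(b)\mathbf q(b)$. For candidates $X,Y$: $\mathbf a_{X>Y}=\sum_{b:\,b(X)<b(Y)}\delta_b$ and $\mathbf r_{X>Y}=\mathbf a_{X>Y}-\mathbf a_{Y>X}$; by convention, $X$ defeats $Y$ in a head-to-head race in $\mathbf p$ iff $\mathbf p\cdot\mathbf r_{X>Y}>0$. For $\mathbf w\in\mathbb R^m$ (a function $[m]\to\mathbb R$) and $X\in\mathbf C$, $\mathbf v_X\in P$ is $\mathbf v_X(b)=\mathbf w(b(X))$; the positional voting method $B_{\mathbf w}:P\to\mathbb R^{\mathbf C}$ is $B_{\mathbf w}(\mathbf p)(X)=\mathbf p\cdot\mathbf v_X$. A map $F:P\to\mathbb R^{\mathbf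 C}$ is trivial if $F(\mathbf p)$ is a constant function on $\mathbf C$ for every $\mathbf p$, and nontrivial otherwise. $F$ satisfies the strong majority criterion if for every ordered pair of distinct candidates $X,Y$ and every $\mathbf p\in P$ with $\mathbf p\cdot\mathbf r_{X>Y}>0$, we have $F(\mathbf p)(X)>F(\mathbf p)(Y)$. -}

module Defs where

open import Data.Nat.Base as ℕ using (ℕ; zero; suc)
import Data.Nat.Properties as ℕ
open import Data.Fin.Base as Fin using (Fin)
import Data.Fin.Properties as Fin
open import Data.Rational.Base as ℚ using (ℚ; 0ℚ; 1ℚ; ½; ∣_∣)
import Data.Rational.Properties as ℚ
open import Data.Rational.Solver using (module +-*-Solver)
open import Data.List.Base as List using (List; []; _∷_)
open import Data.List.Membership.Propositional using (_∈_)
open import Data.List.Membership.Propositional.Properties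
  using (∈-allFin; ∈-cartesianProductWith⁺)
open import Data.List.Relation.Unary.All as All using (All)
open import Data.List.Relation.Unary.Any using (here; there)
open import Data.List.Relation.Unary.AllPairs using ([]; _∷_)
open import Data.List.Relation.Unary.Unique.Propositional using (Unique)
import Data.List.Relation.Unary.Unique.Propositional.Properties as Unique
open import Data.Vec.Base as Vec using (Vec; []; _∷_; lookup)
import Data.Vec.Properties as Vec
open import Data.Product.Base using (∃-syntax; _×_; _,_)
open import Relation.Binary.PropositionalEquality
  using (_≡_; _≢_; refl; sym; trans; cong; cong₂; subst)
open import Relation.Binary.Definitions using (DecidableEquality)
open import Relation.Nullary using (¬_; Dec; yes; no; does; contradiction)
open import Relation.Nullary.Decidable using (recompute; map′)
open import Data.Bool.Base using (if_then_else_)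

-- Cauchy sequences of rationals.  Equality of reals is the relation _≈_,
-- not _≡_.

record ℝ : Set where
  constructor mkℝ
  field
    seq    : ℕ → ℚ
    cauchy : ∀ ε → 0ℚ ℚ.< ε → ∃[ N ] ∀ i j → N ℕ.≤ i → N ℕ.≤ j →
             ∣ seq i ℚ.- seq j ∣ ℚ.< ε

open ℝ public

infix 4 _≈_ _<_ _>_

_≈_ : ℝ → ℝ → Set
x ≈ y = ∀ ε → 0ℚ ℚ.< ε → ∃[ N ] ∀ i → N ℕ.≤ i → ∣ seq x i ℚ.- seq y i ∣ ℚ.< ε

-- A fixed rational gap is needed: termwise _<_ alone would only give ≤ in
-- the limit.

_<_ : ℝ → ℝ → Set
x < y = ∃[ ε ] 0ℚ ℚ.< ε × ∃[ N ] ∀ i → N ℕ.≤ i → seq x i ℚ.+ ε ℚ.< seq y i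

_>_ : ℝ → ℝ → Set
x > y = y < x

fromℚ : ℚ → ℝ
fromℚ q = mkℝ (λ _ → q) λ ε 0<ε →
  0 , λ _ _ _ _ → subst (λ z → ∣ z ∣ ℚ.< ε) (sym (ℚ.+-inverseʳ q)) 0<ε

0ℝ 1ℝ : ℝ
0ℝ = fromℚ 0ℚ
1ℝ = fromℚ 1ℚ

private
  open +-*-Solver

  0<*½ : ∀ {ε} → 0ℚ ℚ.< ε → 0ℚ ℚ.< ε ℚ.* ½
  0<*½ {ε} 0<ε = ℚ.positive⁻¹ _ {{ℚ.pos*pos⇒pos ε {{ℚ.positive 0<ε}} ½}}

  half+half : ∀ ε → ε ℚ.* ½ ℚ.+ ε ℚ.* ½ ≡ ε
  half+half ε = trans (sym (ℚ.*-distribˡ-+ ε ½ ½)) (ℚ.*-identityʳ ε)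

  +-rearrange : ∀ a b c d → (a ℚ.+ b) ℚ.- (c ℚ.+ d) ≡ (a ℚ.- c) ℚ.+ (b ℚ.- d)
  +-rearrange = solve 4
    (λ a b c d → (a :+ b) :- (c :+ d) := (a :- c) :+ (b :- d)) refl

  neg-rearrange : ∀ a b → (ℚ.- a) ℚ.- (ℚ.- b) ≡ ℚ.- (a ℚ.- b)
  neg-rearrange = solve 2 (λ a b → (:- a) :- (:- b) := :- (a :- b)) refl

  *-rearrange : ∀ a b c d →
    a ℚ.* b ℚ.- c ℚ.* d ≡ a ℚ.* (b ℚ.- d) ℚ.+ d ℚ.* (a ℚ.- c)
  *-rearrange = solve 4
    (λ a b c d → a :* b :- c :* d := a :* (b :- d) :+ d :* (a :- c)) refl

  +-cancel-mid : ∀ a b → b ℚ.+ (a ℚ.- b) ≡ a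
  +-cancel-mid = solve 2 (λ a b → b :+ (a :- b) := a) refl

eventuallyBounded : ∀ x → ∃[ B ] 0ℚ ℚ.< B × ∃[ N ] ∀ i → N ℕ.≤ i → ∣ seq x i ∣ ℚ.≤ B
eventuallyBounded x with N , h ← cauchy x 1ℚ (ℚ.positive⁻¹ 1ℚ) =
    ∣ seq x N ∣ ℚ.+ 1ℚ
  , ℚ.+-mono-≤-< (ℚ.0≤∣p∣ (seq x N)) (ℚ.positive⁻¹ 1ℚ)
  , N
  , λ i N≤i → let open ℚ.≤-Reasoning in begin
      ∣ seq x i ∣                              ≡⟨ cong ∣_∣ (+-cancel-mid (seq x i) (seq x N)) ⟨
      ∣ seq x N ℚ.+ (seq x i ℚ.- seq x N) ∣    ≤⟨ ℚ.∣p+q∣≤∣p∣+∣q∣ (seq x N) _ ⟩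
      ∣ seq x N ∣ ℚ.+ ∣ seq x i ℚ.- seq x N ∣  ≤⟨ ℚ.+-monoʳ-≤ ∣ seq x N ∣ (ℚ.<⇒≤ (h i N N≤i ℕ.≤-refl)) ⟩
      ∣ seq x N ∣ ℚ.+ 1ℚ                       ∎

infixl 6 _+_ _-_
infixl 7 _*_
infix  8 -_

_+_ : ℝ → ℝ → ℝ
x + y = mkℝ (λ i → seq x i ℚ.+ seq y i) λ ε 0<ε →
  let M , hx = cauchy x (ε ℚ.* ½) (0<*½ 0<ε)
      N , hy = cauchy y (ε ℚ.* ½) (0<*½ 0<ε)
  in M ℕ.⊔ N , λ i j ≤i ≤j → let open ℚ.≤-Reasoning in begin-strict
    ∣ (seq x i ℚ.+ seq y i) ℚ.- (seq x j ℚ.+ seq y j) ∣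
      ≡⟨ cong ∣_∣ (+-rearrange (seq x i) (seq y i) (seq x j) (seq y j)) ⟩
    ∣ (seq x i ℚ.- seq x j) ℚ.+ (seq y i ℚ.- seq y j) ∣
      ≤⟨ ℚ.∣p+q∣≤∣p∣+∣q∣ (seq x i ℚ.- seq x j) _ ⟩
    ∣ seq x i ℚ.- seq x j ∣ ℚ.+ ∣ seq y i ℚ.- seq y j ∣
      <⟨ ℚ.+-mono-< (hx i j (ℕ.m⊔n≤o⇒m≤o M N ≤i) (ℕ.m⊔n≤o⇒m≤o M N ≤j))
                    (hy i j (ℕ.m⊔n≤o⇒n≤o M N ≤i) (ℕ.m⊔n≤o⇒n≤o M N ≤j)) ⟩
    ε ℚ.* ½ ℚ.+ ε ℚ.* ½
      ≡⟨ half+half ε ⟩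
    ε ∎

-_ : ℝ → ℝ
- x = mkℝ (λ i → ℚ.- seq x i) λ ε 0<ε →
  let N , h = cauchy x ε 0<ε
  in N , λ i j ≤i ≤j → subst (ℚ._< ε)
    (sym (trans (cong ∣_∣ (neg-rearrange (seq x i) (seq x j)))
                (ℚ.∣-p∣≡∣p∣ (seq x i ℚ.- seq x j))))
    (h i j ≤i ≤j)

_-_ : ℝ → ℝ → ℝ
x - y = x + (- y)

_*_ : ℝ → ℝ → ℝ
x * y = mkℝ (λ i → seq x i ℚ.* seq y i) λ ε 0<ε →
  let A , 0<A , K , bx = eventuallyBounded x
      B , 0<B , L , by = eventuallyBounded y
      instance
        posA : ℚ.Positive A
        posA = ℚ.positive 0<A
        posB : ℚ.Positive B
        posB = ℚ.positive 0<B
        posA+B : ℚ.Positive (A ℚ.+ B)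
        posA+B = ℚ.pos+pos⇒pos A B
        nzA+B : ℚ.NonZero (A ℚ.+ B)
        nzA+B = ℚ.pos⇒nonZero (A ℚ.+ B)
        posε : ℚ.Positive ε
        posε = ℚ.positive 0<ε
        posInv : ℚ.Positive (ℚ.1/ (A ℚ.+ B))
        posInv = ℚ.1/pos⇒pos (A ℚ.+ B)
      δ = ℚ.1/ (A ℚ.+ B) ℚ.* ε
      0<δ = ℚ.positive⁻¹ δ {{ℚ.pos*pos⇒pos (ℚ.1/ (A ℚ.+ B)) ε}}
      M , hx = cauchy x δ 0<δ
      N , hy = cauchy y δ 0<δ
      KL = K ℕ.⊔ L
      MN = M ℕ.⊔ N
  in KL ℕ.⊔ MN , λ i j ≤i ≤j →
    let open ℚ.≤-Reasoning
        K≤i = ℕ.m⊔n≤o⇒m≤o K L (ℕ.m⊔n≤o⇒m≤o KL MN ≤i)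
        L≤j = ℕ.m⊔n≤o⇒n≤o K L (ℕ.m⊔n≤o⇒m≤o KL MN ≤j)
        MN≤i = ℕ.m⊔n≤o⇒n≤o KL MN ≤i
        MN≤j = ℕ.m⊔n≤o⇒n≤o KL MN ≤j
        dx = seq x i ℚ.- seq x j
        dy = seq y i ℚ.- seq y j
    in begin-strict
    ∣ seq x i ℚ.* seq y i ℚ.- seq x j ℚ.* seq y j ∣
      ≡⟨ cong ∣_∣ (*-rearrange (seq x i) (seq y i) (seq x j) (seq y j)) ⟩
    ∣ seq x i ℚ.* dy ℚ.+ seq y j ℚ.* dx ∣
      ≤⟨ ℚ.∣p+q∣≤∣p∣+∣q∣ (seq x i ℚ.* dy) _ ⟩
    ∣ seq x i ℚ.* dy ∣ ℚ.+ ∣ seq y j ℚ.* dx ∣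
      ≡⟨ cong₂ ℚ._+_ (ℚ.∣p*q∣≡∣p∣*∣q∣ (seq x i) dy) (ℚ.∣p*q∣≡∣p∣*∣q∣ (seq y j) dx) ⟩
    ∣ seq x i ∣ ℚ.* ∣ dy ∣ ℚ.+ ∣ seq y j ∣ ℚ.* ∣ dx ∣
      ≤⟨ ℚ.+-mono-≤
           (ℚ.*-monoʳ-≤-nonNeg ∣ dy ∣ {{ℚ.∣-∣-nonNeg dy}} (bx i K≤i))
           (ℚ.*-monoʳ-≤-nonNeg ∣ dx ∣ {{ℚ.∣-∣-nonNeg dx}} (by j L≤j)) ⟩
    A ℚ.* ∣ dy ∣ ℚ.+ B ℚ.* ∣ dx ∣
      <⟨ ℚ.+-mono-<
           (ℚ.*-monoʳ-<-pos A (hy i j (ℕ.m⊔n≤o⇒n≤o M N MN≤i) (ℕ.m⊔n≤o⇒n≤o M N MN≤j)))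
           (ℚ.*-monoʳ-<-pos B (hx i j (ℕ.m⊔n≤o⇒m≤o M N MN≤i) (ℕ.m⊔n≤o⇒m≤o M N MN≤j))) ⟩
    A ℚ.* δ ℚ.+ B ℚ.* δ
      ≡⟨ ℚ.*-distribʳ-+ δ A B ⟨
    (A ℚ.+ B) ℚ.* δ
      ≡⟨ ℚ.*-assoc (A ℚ.+ B) (ℚ.1/ (A ℚ.+ B)) ε ⟨
    (A ℚ.+ B) ℚ.* ℚ.1/ (A ℚ.+ B) ℚ.* ε
      ≡⟨ cong (ℚ._* ε) (ℚ.*-inverseʳ (A ℚ.+ B)) ⟩
    1ℚ ℚ.* ε
      ≡⟨ ℚ.*-identityˡ ε ⟩
    ε ∎

∑ : ∀ {A : Set} → List A → (A → ℝ) → ℝ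
∑ xs f = List.foldr (λ a s → f a + s) 0ℝ xs

record Composition (n m : ℕ) : Set where
  field
    parts    : Vec ℕ m
    positive : ∀ i → 0 ℕ.< lookup parts i
    total    : Vec.sum parts ≡ n

open Composition public

-- The candidates are the elements of Fin n and the levels 1,…,m are the
-- elements 0,…,m-1 of Fin m, in the same order.  A function from candidates to
-- levels is stored as a vector, and its level sizes irrelevantly, so that
-- propositional equality of ballots is equality of functions.

IsBallot : ∀ {n m} → Composition n m → Vec (Fin m) n → Set
IsBallot Λ v = ∀ i → Vec.count (Fin._≟ i) v ≡ lookup (parts Λ) i

record Ballot {n m : ℕ} (Λ : Composition n m) : Set where
  constructor mkBallot
  field
    levels    : Vec (Fin m) n
    .isBallot : IsBallot Λ levels

open Ballot public using (levels)

module _ {n m : ℕ} {Λ : Composition n m} where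

  level : Ballot Λ → Fin n → Fin m
  level b X = lookup (levels b) X

  isBallot? : ∀ v → Dec (IsBallot Λ v)
  isBallot? v = Fin.all? λ i → Vec.count (Fin._≟ i) v ℕ.≟ lookup (parts Λ) i

  levels-injective : ∀ {b c : Ballot Λ} → levels b ≡ levels c → b ≡ c
  levels-injective refl = refl

  _≟ᵇ_ : DecidableEquality (Ballot Λ)
  b ≟ᵇ c = map′ levels-injective (cong levels) (Vec.≡-dec Fin._≟_ (levels b) (levels c))

allVecs : ∀ n m → List (Vec (Fin m) n)
allVecs zero    m = [] ∷ []
allVecs (suc n) m = List.cartesianProductWith _∷_ (List.allFin m) (allVecs n m)

module _ {n m : ℕ} (Λ : Composition n m) where

  selectBallots : List (Vec (Fin m) n) → List (Ballot Λ)
  selectBallots []       = []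
  selectBallots (v ∷ vs) with isBallot? {Λ = Λ} v
  ... | yes ok = mkBallot v ok ∷ selectBallots vs
  ... | no  _  = selectBallots vs

  ballots : List (Ballot Λ)
  ballots = selectBallots (allVecs n m)

-- The list ballots Λ contains every ballot exactly once, so summing over it
-- is summing over the set of ballots.

∈-allVecs : ∀ {n m} (v : Vec (Fin m) n) → v ∈ allVecs n m
∈-allVecs []      = here refl
∈-allVecs (i ∷ v) = ∈-cartesianProductWith⁺ _∷_ (∈-allFin i) (∈-allVecs v)

allVecs-unique : ∀ n m → Unique (allVecs n m)
allVecs-unique zero    m = All.[] ∷ []
allVecs-unique (suc n) m =
  Unique.cartesianProductWith⁺ _∷_ Vec.∷-injective (Unique.allFin⁺ m) (allVecs-unique n m)

module _ {n m : ℕ} {Λ : Composition n m} where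

  ∈-selectBallots : ∀ {vs} (b : Ballot Λ) → levels b ∈ vs → b ∈ selectBallots Λ vs
  ∈-selectBallots {v ∷ _} b b∈ with isBallot? {Λ = Λ} v | b∈
  ... | yes _ | here eq  = here (levels-injective eq)
  ... | yes _ | there b∈′ = there (∈-selectBallots b b∈′)
  ... | no  _ | there b∈′ = ∈-selectBallots b b∈′
  ∈-selectBallots {v ∷ _} (mkBallot .v ok) _ | no ¬ok | here refl =
    contradiction (λ i → recompute (_ ℕ.≟ _) (ok i)) ¬ok

  ∈-ballots : (b : Ballot Λ) → b ∈ ballots Λ
  ∈-ballots b = ∈-selectBallots b (∈-allVecs (levels b))

  selectBallots-fresh : ∀ {v vs} → All (v ≢_) vs →
    ∀ .{ok : IsBallot Λ v} → All (mkBallot v ok ≢_) (selectBallots Λ vs)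
  selectBallots-fresh All.[] = All.[]
  selectBallots-fresh (All._∷_ {x = u} v≢u rest) with isBallot? {Λ = Λ} u
  ... | yes _ = (λ eq → v≢u (cong levels eq)) All.∷ selectBallots-fresh rest
  ... | no  _ = selectBallots-fresh rest

  selectBallots-unique : ∀ {vs} → Unique vs → Unique (selectBallots Λ vs)
  selectBallots-unique [] = []
  selectBallots-unique {v ∷ _} (fresh ∷ rest) with isBallot? {Λ = Λ} v
  ... | yes _ = selectBallots-fresh fresh ∷ selectBallots-unique rest
  ... | no  _ = selectBallots-unique rest

  ballots-unique : Unique (ballots Λ)
  ballots-unique = selectBallots-unique (allVecs-unique n m)

module _ {n m : ℕ} (Λ : Composition n m) where

  Profile : Set
  Profile = Ballot Λ → ℝ

  VotingMethod : Set
  VotingMethod = Profile → Fin n → ℝ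

module _ {n m : ℕ} {Λ : Composition n m} where

  infixl 7 _·_

  _·_ : Profile Λ → Profile Λ → ℝ
  p · q = ∑ (ballots Λ) λ b → p b * q b

  δ : Ballot Λ → Profile Λ
  δ b c = if does (b ≟ᵇ c) then 1ℝ else 0ℝ

  a[_>_] : Fin n → Fin n → Profile Λ
  a[ X > Y ] c =
    ∑ (List.filter (λ b → level b X Fin.<? level b Y) (ballots Λ)) λ b → δ b c

  r[_>_] : Fin n → Fin n → Profile Λ
  r[ X > Y ] c = a[ X > Y ] c - a[ Y > X ] c

  v[_,_] : (Fin m → ℝ) → Fin n → Profile Λ
  v[ w , X ] b = w (level b X)

  Trivial : VotingMethod Λ → Set
  Trivial F = ∀ p X Y → F p X ≈ F p Y

  Nontrivial : VotingMethod Λ → Set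
  Nontrivial F = ¬ Trivial F

  StrongMajority : VotingMethod Λ → Set
  StrongMajority F = ∀ X Y → X ≢ Y → ∀ p → p · r[ X > Y ] > 0ℝ → F p X > F p Y

Positional : ∀ {n m} (Λ : Composition n m) → (Fin m → ℝ) → VotingMethod Λ
Positional Λ w p X = p · v[ w , X ]

{-# OPTIONS --safe #-}
-- For (a): with two levels, v_X − v_Y = (w(1) − w(2)) r_{X>Y}, and conversely
-- one tests the criterion on δ_b with b(X) = 1 and b(Y) = 2.
-- For (b): writing 1, 2, 3 for the first three levels, let b₁, b₂, b₃ send (X , Y) to (1 , 2), (2 , 3), (1 , 3).  The profile
-- p = δ_b₁ + δ_b₂ − δ_b₃ has p · r_{X>Y} = 1, yet gives X and Y the same score w(2).
-- All identities between reals involved hold termwise for the representing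
-- sequences of rationals.
module Submission where

open import Defs
open import Data.Nat.Base as ℕ using (ℕ; zero; suc; pred; s≤s; z≤n)
import Data.Nat.Properties as ℕ
open import Data.Fin.Base as Fin using (Fin; zero; suc)
import Data.Fin.Properties as Fin
open import Data.Rational.Base as ℚ using (ℚ; 0ℚ; 1ℚ; ½)
import Data.Rational.Properties as ℚ
open import Data.Rational.Solver using (module +-*-Solver)
open import Data.Empty using (⊥)
open import Data.Bool.Base using (if_then_else_)
open import Data.List.Base as List using (List; []; _∷_)
open import Data.List.Membership.Propositional using (_∈_)
open import Data.List.Membership.Propositional.Properties using (∈-filter⁺; ∈-filter⁻)
open import Data.List.Relation.Unary.All as All using ()
open import Data.List.Relation.Unary.Any using (here; there)
open import Data.List.Relation.Unary.AllPairs using (_∷_)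
open import Data.List.Relation.Unary.Unique.Propositional using (Unique)
import Data.List.Relation.Unary.Unique.Propositional.Properties as Unique
open import Data.Vec.Base as Vec using (Vec; []; _∷_; lookup)
import Data.Vec.Properties as Vec
open import Data.Product.Base using (∃-syntax; _×_; _,_; proj₂)
open import Function.Base using (_∘_)
open import Function.Bundles using (_⇔_; mk⇔)
open import Relation.Binary.PropositionalEquality
open import Relation.Nullary using (¬_; Dec; yes; no; does)
open import Relation.Nullary.Decidable using (dec-true; dec-false)

-- Ballots with prescribed levels

positive-part : ∀ {m n} (f : Vec ℕ m) → Vec.sum f ≡ suc n → ∃[ i ] 0 ℕ.< lookup f i
positive-part (suc x ∷ f) eq = zero , s≤s z≤n
positive-part (zero  ∷ f) eq with positive-part f eq
... | i , 0<fᵢ = suc i , 0<fᵢ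

sum≡0⇒lookup≡0 : ∀ {m} (f : Vec ℕ m) → Vec.sum f ≡ 0 → ∀ i → lookup f i ≡ 0
sum≡0⇒lookup≡0 (x ∷ f) eq zero    = ℕ.m+n≡0⇒m≡0 x eq
sum≡0⇒lookup≡0 (x ∷ f) eq (suc i) = sum≡0⇒lookup≡0 f (ℕ.m+n≡0⇒n≡0 x eq) i

-- `pred` is truncated at 0, so pulling it out of a sum `x + _` requires the remaining sum to be
-- positive; the positive entry at `i` ensures this.
sum-updateAt-pred : ∀ {m} (f : Vec ℕ m) i → 0 ℕ.< lookup f i →
  Vec.sum (Vec.updateAt f i pred) ≡ pred (Vec.sum f)
sum-updateAt-pred (suc x ∷ f) zero    _    = refl
sum-updateAt-pred (x     ∷ f) (suc i) 0<fᵢ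
  rewrite sum-updateAt-pred f i 0<fᵢ = +-pred x (Vec.sum f) (<-sum f i 0<fᵢ)
  where
  +-pred : ∀ a b → 0 ℕ.< b → a ℕ.+ pred b ≡ pred (a ℕ.+ b)
  +-pred a (suc b) _ = sym (cong pred (ℕ.+-suc a b))

  <-sum : ∀ {m} (f : Vec ℕ m) i → 0 ℕ.< lookup f i → 0 ℕ.< Vec.sum f
  <-sum (x ∷ f) zero    0<x  = ℕ.≤-trans 0<x (ℕ.m≤m+n x (Vec.sum f))
  <-sum (x ∷ f) (suc i) 0<fᵢ = ℕ.≤-trans (<-sum f i 0<fᵢ) (ℕ.m≤n+m (Vec.sum f) x)

HasCounts : ∀ {m n} → Vec ℕ m → Vec (Fin m) n → Set
HasCounts f v = ∀ k → Vec.count (Fin._≟ k) v ≡ lookup f k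

-- A candidate put at level `i` takes one of its places, so the remaining candidates only have to
-- fill `f` lowered at `i`. The counts at all other levels are unaffected.
HasCounts-∷ : ∀ {m n} (f : Vec ℕ m) (v : Vec (Fin m) n) i → 0 ℕ.< lookup f i →
  HasCounts (Vec.updateAt f i pred) v → HasCounts f (i ∷ v)
HasCounts-∷ f v i 0<fᵢ counts k with i Fin.≟ k
... | yes refl = trans (cong suc (trans (counts i) (Vec.lookup∘updateAt i f)))
                       (ℕ.suc-pred (lookup f i) {{ℕ.>-nonZero 0<fᵢ}})
... | no i≢k   = trans (counts k) (Vec.lookup∘updateAt′ k i (i≢k ∘ sym) f)

-- Greedy filling: as long as the capacities have a positive sum, some level has a free place, and
-- the next candidate goes there. Once the sum is 0, every capacity is 0.
withCounts : ∀ {m} n (f : Vec ℕ m) → Vec.sum f ≡ n → ∃[ v ] HasCounts {n = n} f v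
withCounts zero    f eq = [] , λ k → sym (sum≡0⇒lookup≡0 f eq k)
withCounts (suc n) f eq =
  let i , 0<fᵢ   = positive-part f eq
      v , counts = withCounts n (Vec.updateAt f i pred)
        (trans (sum-updateAt-pred f i 0<fᵢ) (cong pred eq))
  in i ∷ v , HasCounts-∷ f v i 0<fᵢ counts

-- The first two candidates go to `i` and `j`; the others are distributed greedily over the places
-- left.
ballotWith : ∀ {m n} (Λ : Composition (suc (suc n)) m) {i j} → i ≢ j →
  ∃[ b ] level {Λ = Λ} b zero ≡ i × level b (suc zero) ≡ j
ballotWith Λ {i} {j} i≢j =
  let f          = parts Λ
      0<fᵢ       = positive Λ i
      g          = Vec.updateAt f i pred
      -- As `i ≢ j`, the first decrement leaves the capacity of `j` intact, so a place remains there
      -- even if every part is 1.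
      0<gⱼ       = subst (0 ℕ.<_) (sym (Vec.lookup∘updateAt′ j i (i≢j ∘ sym) f)) (positive Λ j)
      v , counts = withCounts _ (Vec.updateAt g j pred)
        (trans (sum-updateAt-pred g j 0<gⱼ)
               (cong pred (trans (sum-updateAt-pred f i 0<fᵢ) (cong pred (total Λ)))))
  in mkBallot (i ∷ j ∷ v)
       (HasCounts-∷ f (j ∷ v) i 0<fᵢ (HasCounts-∷ g v j 0<gⱼ counts))
   , refl , refl

-- Sums, termwise

open +-*-Solver using (solve; _:=_; _:+_; _:*_; _:-_; :-_; con)

indicator : ∀ {P : Set} → Dec P → ℚ
indicator P? = if does P? then 1ℚ else 0ℚ

-- The value (1, -1 or 0) of `r[ X > Y ]` on a ballot with `X` at level `i` and `Y` at level `j`;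
-- see `seq-r`.
sign : ∀ {m} → Fin m → Fin m → ℚ
sign i j = indicator (i Fin.<? j) ℚ.- indicator (j Fin.<? i)

module _ {A : Set} where

  ∑ℚ : List A → (A → ℚ) → ℚ
  ∑ℚ []       f = 0ℚ
  ∑ℚ (x ∷ xs) f = f x ℚ.+ ∑ℚ xs f

  seq-∑ : ∀ k xs (f : A → ℝ) → seq (∑ xs f) k ≡ ∑ℚ xs (λ a → seq (f a) k)
  seq-∑ k []       f = refl
  seq-∑ k (x ∷ xs) f = cong (seq (f x) k ℚ.+_) (seq-∑ k xs f)

  -- One form serves every use: `c` is 1 or -1 when a test profile is split into its basis vectors,
  -- and the difference of the two weights when scores are compared.
  ∑ℚ-linear : ∀ c xs (f g h : A → ℚ) → (∀ a → h a ≡ f a ℚ.+ c ℚ.* g a) →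
    ∑ℚ xs h ≡ ∑ℚ xs f ℚ.+ c ℚ.* ∑ℚ xs g
  ∑ℚ-linear c []       f g h eq = sym (trans (ℚ.+-identityˡ _) (ℚ.*-zeroʳ c))
  ∑ℚ-linear c (x ∷ xs) f g h eq = trans (cong₂ ℚ._+_ (eq x) (∑ℚ-linear c xs f g h eq))
    (solve 5 (λ a b c s t → (a :+ c :* b) :+ (s :+ c :* t) := (a :+ s) :+ c :* (b :+ t))
       refl (f x) (g x) c (∑ℚ xs f) (∑ℚ xs g))

  ∑ℚ-zero : ∀ xs (f : A → ℚ) → (∀ {a} → a ∈ xs → f a ≡ 0ℚ) → ∑ℚ xs f ≡ 0ℚ
  ∑ℚ-zero []       f eq = refl
  ∑ℚ-zero (x ∷ xs) f eq =
    trans (cong₂ ℚ._+_ (eq (here refl)) (∑ℚ-zero xs f (eq ∘ there))) (ℚ.+-identityˡ 0ℚ)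

  -- Uniqueness guarantees that `f c` is counted only once: freshness makes every other entry differ
  -- from `c`.
  ∑ℚ-single : ∀ {xs c} (f : A → ℚ) → Unique xs → c ∈ xs →
    (∀ {a} → a ≢ c → f a ≡ 0ℚ) → ∑ℚ xs f ≡ f c
  ∑ℚ-single {c ∷ xs} f (fresh ∷ _) (here refl) eq =
    trans (cong (f c ℚ.+_) (∑ℚ-zero xs f λ a∈xs → eq (All.lookup fresh a∈xs ∘ sym)))
          (ℚ.+-identityʳ (f c))
  ∑ℚ-single f (fresh ∷ unique) (there c∈xs) eq =
    trans (cong₂ ℚ._+_ (eq (All.lookup fresh c∈xs)) (∑ℚ-single f unique c∈xs eq))
          (ℚ.+-identityˡ _)

-- Profiles, termwise

δ+δ-δ : ∀ {n m} {Λ : Composition n m} (b c d : Ballot Λ) → Profile Λ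
δ+δ-δ b c d a = δ b a + δ c a - δ d a

module _ (k : ℕ) {n m : ℕ} {Λ : Composition n m} where

  δ-same : (b : Ballot Λ) → seq (δ b b) k ≡ 1ℚ
  δ-same b = cong (λ t → seq (if t then 1ℝ else 0ℝ) k) (dec-true (b ≟ᵇ b) refl)

  δ-distinct : {b c : Ballot Λ} → b ≢ c → seq (δ b c) k ≡ 0ℚ
  δ-distinct {b} {c} b≢c =
    cong (λ t → seq (if t then 1ℝ else 0ℝ) k) (dec-false (b ≟ᵇ c) b≢c)

  seq-· : ∀ (p q : Profile Λ) →
    seq (p · q) k ≡ ∑ℚ (ballots Λ) (λ b → seq (p b) k ℚ.* seq (q b) k)
  seq-· p q = seq-∑ k (ballots Λ) (λ b → p b * q b)

  ∑ℚ-δ : ∀ (b : Ballot Λ) (g : Ballot Λ → ℚ) →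
    ∑ℚ (ballots Λ) (λ a → seq (δ b a) k ℚ.* g a) ≡ g b
  ∑ℚ-δ b g = trans
    (∑ℚ-single (λ a → seq (δ b a) k ℚ.* g a) ballots-unique (∈-ballots b) λ {a} a≢b →
      trans (cong (ℚ._* g a) (δ-distinct (a≢b ∘ sym))) (ℚ.*-zeroˡ (g a)))
    (trans (cong (ℚ._* g b) (δ-same b)) (ℚ.*-identityˡ (g b)))

  δ-· : ∀ (b : Ballot Λ) q → seq (δ b · q) k ≡ seq (q b) k
  δ-· b q = trans (seq-· (δ b) q) (∑ℚ-δ b λ a → seq (q a) k)

  δ+δ-δ-· : ∀ (b c d : Ballot Λ) q →
    seq (δ+δ-δ b c d · q) k ≡ (seq (q b) k ℚ.+ seq (q c) k) ℚ.- seq (q d) k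
  δ+δ-δ-· b c d q = begin
    seq (δ+δ-δ b c d · q) k
      ≡⟨ seq-· (δ+δ-δ b c d) q ⟩
    ∑ℚ (ballots Λ) (λ a → ((δ′ b a ℚ.+ δ′ c a) ℚ.- δ′ d a) ℚ.* g a)
      ≡⟨ ∑ℚ-linear (ℚ.- 1ℚ) (ballots Λ)
           (λ a → (δ′ b a ℚ.+ δ′ c a) ℚ.* g a) (λ a → δ′ d a ℚ.* g a) _
           (λ a → solve 3 (λ s t r → (s :- t) :* r := s :* r :+ :- con 1ℚ :* (t :* r))
                    refl (δ′ b a ℚ.+ δ′ c a) (δ′ d a) (g a)) ⟩
    ∑ℚ (ballots Λ) (λ a → (δ′ b a ℚ.+ δ′ c a) ℚ.* g a) ℚ.+ (ℚ.- 1ℚ) ℚ.* S d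
      ≡⟨ cong (ℚ._+ (ℚ.- 1ℚ) ℚ.* S d) (∑ℚ-linear 1ℚ (ballots Λ)
           (λ a → δ′ b a ℚ.* g a) (λ a → δ′ c a ℚ.* g a) _
           (λ a → solve 3 (λ s t r → (s :+ t) :* r := s :* r :+ con 1ℚ :* (t :* r))
                    refl (δ′ b a) (δ′ c a) (g a))) ⟩
    (S b ℚ.+ 1ℚ ℚ.* S c) ℚ.+ (ℚ.- 1ℚ) ℚ.* S d
      ≡⟨ solve 3 (λ s t r → (s :+ con 1ℚ :* t) :+ :- con 1ℚ :* r := (s :+ t) :- r) refl
           (S b) (S c) (S d) ⟩
    (S b ℚ.+ S c) ℚ.- S d
      ≡⟨ cong₂ ℚ._-_ (cong₂ ℚ._+_ (∑ℚ-δ b g) (∑ℚ-δ c g)) (∑ℚ-δ d g) ⟩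
    (g b ℚ.+ g c) ℚ.- g d ∎
    where
    open ≡-Reasoning
    δ′ : Ballot Λ → Ballot Λ → ℚ
    δ′ b a = seq (δ b a) k

    g : Ballot Λ → ℚ
    g a = seq (q a) k

    S : Ballot Λ → ℚ
    S b = ∑ℚ (ballots Λ) (λ a → δ′ b a ℚ.* g a)

  -- For fixed `c`, only the term `b = c` of the sum of the `δ b c` can be nonzero, and `c` survives
  -- the filter exactly when it ranks `X` before `Y`.
  seq-a : ∀ X Y (c : Ballot Λ) → seq (a[ X > Y ] c) k ≡ indicator (level c X Fin.<? level c Y)
  seq-a X Y c = trans (seq-∑ k (List.filter X>Y? (ballots Λ)) (λ b → δ b c)) (by-cases (X>Y? c))
    where
    X>Y? : ∀ b → Dec (level b X Fin.< level b Y)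
    X>Y? b = level b X Fin.<? level b Y

    by-cases : Dec (level c X Fin.< level c Y) →
      ∑ℚ (List.filter X>Y? (ballots Λ)) (λ b → seq (δ b c) k) ≡ indicator (X>Y? c)
    by-cases (yes cX<cY) = trans
      (∑ℚ-single (λ b → seq (δ b c) k) (Unique.filter⁺ X>Y? ballots-unique)
        (∈-filter⁺ X>Y? (∈-ballots c) cX<cY) δ-distinct)
      (trans (δ-same c) (sym (cong (λ t → if t then 1ℚ else 0ℚ) (dec-true (X>Y? c) cX<cY))))
    by-cases (no cX≮cY) = trans
      (∑ℚ-zero (List.filter X>Y? (ballots Λ)) (λ b → seq (δ b c) k) λ {b} b∈ → δ-distinct {b} {c}
        λ b≡c → cX≮cY (subst (λ b → level b X Fin.< level b Y) b≡c
          (proj₂ (∈-filter⁻ X>Y? {v = b} {xs = ballots Λ} b∈))))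
      (sym (cong (λ t → if t then 1ℚ else 0ℚ) (dec-false (X>Y? c) cX≮cY)))

  seq-r : ∀ X Y (c : Ballot Λ) → seq (r[ X > Y ] c) k ≡ sign (level c X) (level c Y)
  seq-r X Y c = cong₂ ℚ._-_ (seq-a X Y c) (seq-a Y X c)

-- Order on the reals

0<½ : 0ℚ ℚ.< ½
0<½ = ℚ.positive⁻¹ ½

≡1⇒>0 : ∀ x → (∀ k → seq x k ≡ 1ℚ) → x > 0ℝ
≡1⇒>0 x eq = ½ , 0<½ , 0 , λ k _ → subst (0ℚ ℚ.+ ½ ℚ.<_) (sym (eq k)) ½<1
  where
  ½<1 : 0ℚ ℚ.+ ½ ℚ.< 1ℚ
  -- The right-hand side `½ + ½` evaluates to `1ℚ`.
  ½<1 = ℚ.+-monoˡ-< ½ 0<½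

>-resp-≡ : ∀ x x′ y y′ → (∀ k → seq x k ≡ seq x′ k) → (∀ k → seq y k ≡ seq y′ k) →
  x > y → x′ > y′
>-resp-≡ x x′ y y′ x≡x′ y≡y′ (ε , 0<ε , N , h) =
  ε , 0<ε , N , λ k N≤k → subst₂ (λ s t → s ℚ.+ ε ℚ.< t) (y≡y′ k) (x≡x′ k) (h k N≤k)

>-irrefl : ∀ x → ¬ x > x
>-irrefl x (ε , 0<ε , N , h) = ℚ.<-asym (h N ℕ.≤-refl)
  (subst (ℚ._< seq x N ℚ.+ ε) (ℚ.+-identityʳ _) (ℚ.+-monoʳ-< (seq x N) 0<ε))

-- The gaps multiply: if eventually `a - b` exceeds `ε` and `s` exceeds `η`, then their product
-- exceeds `ε * η`, which serves as the gap between `y` and `x`.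
>-scaled-difference : ∀ a b s x y →
  (∀ k → seq x k ≡ seq y k ℚ.+ (seq a k ℚ.- seq b k) ℚ.* seq s k) →
  a > b → s > 0ℝ → x > y
>-scaled-difference a b s x y eq (ε , 0<ε , M , ha) (η , 0<η , N , hs) =
    ε ℚ.* η
  , ℚ.positive⁻¹ _ {{ℚ.pos*pos⇒pos ε η}}
  , M ℕ.⊔ N
  , λ k ≤k →
    let open ℚ.≤-Reasoning
        d   = seq a k ℚ.- seq b k
        ε<d : ε ℚ.< d
        ε<d = subst₂ ℚ._<_
          (solve 2 (λ b ε → (b :+ ε) :- b := ε) refl (seq b k) ε) refl
          (ℚ.+-monoˡ-< (ℚ.- seq b k) (ha k (ℕ.m⊔n≤o⇒m≤o M N ≤k)))
        η<s : η ℚ.< seq s k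
        η<s = subst (ℚ._< seq s k) (ℚ.+-identityˡ η) (hs k (ℕ.m⊔n≤o⇒n≤o M N ≤k))
        -- Positivity of `d` allows the second factor to be enlarged from `η` to `seq s k` after the
        -- first has become `d`.
        instance
          posd : ℚ.Positive d
          posd = ℚ.positive (ℚ.<-trans 0<ε ε<d)
    in begin-strict
      seq y k ℚ.+ ε ℚ.* η        <⟨ ℚ.+-monoʳ-< (seq y k) (ℚ.*-monoˡ-<-pos η ε<d) ⟩
      seq y k ℚ.+ d ℚ.* η        <⟨ ℚ.+-monoʳ-< (seq y k) (ℚ.*-monoʳ-<-pos d η<s) ⟩
      seq y k ℚ.+ d ℚ.* seq s k  ≡⟨ eq k ⟨
      seq x k                    ∎
  where
  instance
    posε : ℚ.Positive ε
    posε = ℚ.positive 0<ε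
    posη : ℚ.Positive η
    posη = ℚ.positive 0<η

-- Positional methods and the strong majority criterion

-- With two levels, the weights of `X` and `Y` on a ballot differ by the `sign` of their levels
-- times `d`, as the four cases of `levelwise` show. Pairing with `p` and summing gives the
-- identity.
score-difference : ∀ {n} {Λ : Composition n 2} (w : Fin 2 → ℝ) p X Y k →
  seq (Positional Λ w p X) k ≡
  seq (Positional Λ w p Y) k ℚ.+
    (seq (w zero) k ℚ.- seq (w (suc zero)) k) ℚ.* seq (p · r[ X > Y ]) k
score-difference {Λ = Λ} w p X Y k = begin
  seq (Positional Λ w p X) k
    ≡⟨ seq-· k p v[ w , X ] ⟩
  ∑ℚ (ballots Λ) (λ b → p′ b ℚ.* w′ (level b X))
    ≡⟨ ∑ℚ-linear d (ballots Λ) (λ b → p′ b ℚ.* w′ (level b Y)) (λ b → p′ b ℚ.* r′ b) _ ballotwise ⟩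
  ∑ℚ (ballots Λ) (λ b → p′ b ℚ.* w′ (level b Y)) ℚ.+ d ℚ.* ∑ℚ (ballots Λ) (λ b → p′ b ℚ.* r′ b)
    ≡⟨ cong₂ (λ s t → s ℚ.+ d ℚ.* t) (seq-· k p v[ w , Y ]) (seq-· k p r[ X > Y ]) ⟨
  seq (Positional Λ w p Y) k ℚ.+ d ℚ.* seq (p · r[ X > Y ]) k ∎
  where
  open ≡-Reasoning
  p′ r′ : Ballot Λ → ℚ
  p′ b = seq (p b) k
  r′ b = seq (r[ X > Y ] b) k

  w′ : Fin 2 → ℚ
  w′ i = seq (w i) k

  d : ℚ
  d = w′ zero ℚ.- w′ (suc zero)

  levelwise : ∀ i j → w′ i ≡ w′ j ℚ.+ d ℚ.* sign i j
  levelwise zero       zero       = solve 2 (λ a b → a := a :+ (a :- b) :* con 0ℚ) refl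
    (w′ zero) (w′ (suc zero))
  levelwise zero       (suc zero) = solve 2 (λ a b → a := b :+ (a :- b) :* con 1ℚ) refl
    (w′ zero) (w′ (suc zero))
  levelwise (suc zero) zero       = solve 2 (λ a b → b := a :+ (a :- b) :* con (ℚ.- 1ℚ)) refl
    (w′ zero) (w′ (suc zero))
  levelwise (suc zero) (suc zero) = solve 2 (λ a b → b := b :+ (a :- b) :* con 0ℚ) refl
    (w′ zero) (w′ (suc zero))

  ballotwise : ∀ b →
    p′ b ℚ.* w′ (level b X) ≡ p′ b ℚ.* w′ (level b Y) ℚ.+ d ℚ.* (p′ b ℚ.* r′ b)
  ballotwise b = begin
    p′ b ℚ.* w′ (level b X)
      ≡⟨ cong (p′ b ℚ.*_) (levelwise (level b X) (level b Y)) ⟩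
    p′ b ℚ.* (w′ (level b Y) ℚ.+ d ℚ.* sign (level b X) (level b Y))
      ≡⟨ cong (λ s → p′ b ℚ.* (w′ (level b Y) ℚ.+ d ℚ.* s)) (seq-r k X Y b) ⟨
    p′ b ℚ.* (w′ (level b Y) ℚ.+ d ℚ.* r′ b)
      ≡⟨ solve 4 (λ p v d s → p :* (v :+ d :* s) := p :* v :+ d :* (p :* s)) refl
           (p′ b) (w′ (level b Y)) d (r′ b) ⟩
    p′ b ℚ.* w′ (level b Y) ℚ.+ d ℚ.* (p′ b ℚ.* r′ b) ∎

decreasing⇒strongMajority : ∀ {n} (Λ : Composition n 2) w →
  w zero > w (suc zero) → StrongMajority (Positional Λ w)
decreasing⇒strongMajority Λ w w₀>w₁ X Y _ p =
  >-scaled-difference (w zero) (w (suc zero)) (p · r[ X > Y ])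
    (Positional Λ w p X) (Positional Λ w p Y) (score-difference {Λ = Λ} w p X Y) w₀>w₁

module _ {n m : ℕ} {Λ : Composition n m} (w : Fin m → ℝ)
         (sm : StrongMajority (Positional Λ w)) {X Y : Fin n} (X≢Y : X ≢ Y) where

  -- The criterion is tested on `δ b`, whose margin is the given `sign` and whose scores are the
  -- weights of the two levels.
  strongMajority⇒w> : (b : Ballot Λ) → sign (level b X) (level b Y) ≡ 1ℚ →
    w (level b X) > w (level b Y)
  strongMajority⇒w> b b-prefers = >-resp-≡
    (Positional Λ w (δ b) X) (w (level b X)) (Positional Λ w (δ b) Y) (w (level b Y))
    (λ k → δ-· k b v[ w , X ]) (λ k → δ-· k b v[ w , Y ])
    (sm X Y X≢Y (δ b) (≡1⇒>0 (δ b · r[ X > Y ]) margin))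
    where
    margin : ∀ k → seq (δ b · r[ X > Y ]) k ≡ 1ℚ
    margin k = trans (δ-· k b r[ X > Y ]) (trans (seq-r k X Y b) b-prefers)

  -- The contributions of `d` cancel the weight of `i` in the score of `X` and that of `l` in the
  -- score of `Y`, so both scores are `w j`. A margin of 1 would then force `w j > w j`.
  chain⇒¬strongMajority : (b c d : Ballot Λ) {i j l : Fin m} →
    level b X ≡ i → level b Y ≡ j →
    level c X ≡ j → level c Y ≡ l →
    level d X ≡ i → level d Y ≡ l →
    (sign i j ℚ.+ sign j l) ℚ.- sign i l ≡ 1ℚ → ⊥
  chain⇒¬strongMajority b c d {i} {j} {l} bX bY cX cY dX dY signs =
    >-irrefl (w j) (>-resp-≡
      (Positional Λ w (δ+δ-δ b c d) X) (w j) (Positional Λ w (δ+δ-δ b c d) Y) (w j)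
      scoreX scoreY (sm X Y X≢Y (δ+δ-δ b c d) (≡1⇒>0 (δ+δ-δ b c d · r[ X > Y ]) margin)))
    where
    combine : ∀ {s s′ t t′ u u′} → s ≡ s′ → t ≡ t′ → u ≡ u′ →
      (s ℚ.+ t) ℚ.- u ≡ (s′ ℚ.+ t′) ℚ.- u′
    combine refl refl refl = refl

    weight : ℕ → Fin m → ℚ
    weight k i = seq (w i) k

    scoreX : ∀ k → seq (Positional Λ w (δ+δ-δ b c d) X) k ≡ weight k j
    scoreX k = trans (δ+δ-δ-· k b c d v[ w , X ]) (trans
      (combine (cong (weight k) bX) (cong (weight k) cX) (cong (weight k) dX))
      (solve 2 (λ s t → (s :+ t) :- s := t) refl (weight k i) (weight k j)))

    scoreY : ∀ k → seq (Positional Λ w (δ+δ-δ b c d) Y) k ≡ weight k j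
    scoreY k = trans (δ+δ-δ-· k b c d v[ w , Y ]) (trans
      (combine (cong (weight k) bY) (cong (weight k) cY) (cong (weight k) dY))
      (solve 2 (λ s t → (s :+ t) :- t := s) refl (weight k j) (weight k l)))

    seq-r′ : ∀ k (e : Ballot Λ) {i j} → level e X ≡ i → level e Y ≡ j →
      seq (r[ X > Y ] e) k ≡ sign i j
    seq-r′ k e eX eY = trans (seq-r k X Y e) (cong₂ sign eX eY)

    margin : ∀ k → seq (δ+δ-δ b c d · r[ X > Y ]) k ≡ 1ℚ
    margin k = trans (δ+δ-δ-· k b c d r[ X > Y ]) (trans
      (combine (seq-r′ k b bX bY) (seq-r′ k c cX cY) (seq-r′ k d dX dY))
      signs)

strongMajority⇒decreasing : ∀ {n} (Λ : Composition (suc (suc n)) 2) w →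
  StrongMajority (Positional Λ w) → w zero > w (suc zero)
strongMajority⇒decreasing Λ w sm =
  let b , bX , bY = ballotWith Λ {zero} {suc zero} (λ ())
  in subst₂ (λ i j → w i > w j) bX bY
       (strongMajority⇒w> w sm {zero} {suc zero} (λ ()) b (cong₂ sign bX bY))

¬strongMajority : ∀ {n m} (Λ : Composition (suc (suc n)) (suc (suc (suc m)))) w →
  ¬ StrongMajority (Positional Λ w)
¬strongMajority Λ w sm =
  let b , bX , bY = ballotWith Λ {zero} {suc zero} (λ ())
      c , cX , cY = ballotWith Λ {suc zero} {suc (suc zero)} (λ ())
      d , dX , dY = ballotWith Λ {zero} {suc (suc zero)} (λ ())
  -- The final `refl` evaluates the margin 1 + 1 - 1 on the three concrete pairs of levels.
  in chain⇒¬strongMajority w sm {zero} {suc zero} (λ ()) b c d bX bY cX cY dX dY refl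

mainTheorem10 : (n : ℕ) → 2 ℕ.≤ n →
    ((Λ : Composition n 2) (w : Fin 2 → ℝ) →
    StrongMajority (Positional Λ w) ⇔ (w zero > w (suc zero)))
    ×
    ((m : ℕ) → m ℕ.> 2 → (Λ : Composition n m) (w : Fin m → ℝ) →
    Nontrivial (Positional Λ w) → ¬ StrongMajority (Positional Λ w))
mainTheorem10 _ (s≤s (s≤s z≤n)) =
    (λ Λ w → mk⇔ (strongMajority⇒decreasing Λ w) (decreasing⇒strongMajority Λ w))
  , λ { _ (s≤s (s≤s (s≤s z≤n))) Λ w _ → ¬strongMajority Λ w }
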